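{- For all $n\ge1$, $\mathbf{cf}_{n,1}(p,q)|_{p^0}=q^{\binom{n}{2}}$. Moreover, $$\mathbf{cf}_{n,1}(p,q)|_{p^1}=\begin{cases}0 & n=1,2,3,\\ \binom{n-2}{2}q^{\binom{n}{2}-2} & n\ge4,\end{cases}$$ $$\mathbf{cf}_{n,1}(p,q)|_{p^2}=\begin{cases}0 & n=1,2,3,4,\\ \left(3\binom{n-1}{4}-\binom{n-3}{2}\right)q^{\binom{n}{2}-4} & n\ge5,\end{cases}$$ $$\mathbf{cf}_{n,1}(p,q)|_{p^3}=\begin{cases}0 & n=1,2,3,4,5,\\ \left(15\binom{n}{6}-6\binom{n-2}{4}+\binom{n-4}{4}\right)q^{\binom{n}{2}-6} & n\ge5.\end{cases}$$
   Context: $F_1(p,q)=q$, $F_2(p,q)=q^2$ and $F_m(p,q)=qF_{m-1}(p,q)+pF_{m-2}(p,q)$ for $m\ge3$. Let $(x)_{\uparrow_{F,p,q,0}}=1$ and $(x)_{\uparrow_{F,p,q,k}}=x(x+F_1(p,q))\cdots(x+F_{k-1}(p,q))$ for $k\ge1$. Define the polynomials $\mathbf{cf}_{n,k}(p,q)$ for $0\le k\le n$ by $(x)_{\uparrow_{F,p,q,n}}=\sum_{k=0}^n\mathbf{cf}_{n,k}(p,q)x^k$. For a polynomial $f$ in $p$ with coefficients in $\mathbb{Q}[q]$, $f|_{p^s}$ denotes the coefficient of $p^s$. -}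

module Defs where

open import Algebra.Bundles.Raw using (RawRing)
import Algebra.Definitions.RawSemiring as RawSemiringDefs
open import Data.Integer using (ℤ)
open import Data.List using (List; []; _∷_; map)
open import Data.Nat using (ℕ; zero; suc)
open import Data.Rational using (_/_; +-*-rawRing)
open import Level using (0ℓ)

-- R[X]: the list a₀ ∷ a₁ ∷ … represents a₀ + a₁X + ⋯.  Trailing zeros are
-- allowed, so equality is equality of all coefficients, not of lists.
module Polynomial {c ℓ} (R : RawRing c ℓ) where

  open RawRing R

  Poly : Set c
  Poly = List Carrier

  coeff : Poly → ℕ → Carrier
  coeff []      _       = 0#
  coeff (a ∷ f) zero    = a
  coeff (a ∷ f) (suc k) = coeff f k

  _≈ᴾ_ : Poly → Poly → Set ℓ
  f ≈ᴾ g = ∀ k → coeff f k ≈ coeff g k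

  _+ᴾ_ : Poly → Poly → Poly
  []      +ᴾ g       = g
  (a ∷ f) +ᴾ []      = a ∷ f
  (a ∷ f) +ᴾ (b ∷ g) = (a + b) ∷ (f +ᴾ g)

  _*ᴾ_ : Poly → Poly → Poly
  []      *ᴾ g = []
  (a ∷ f) *ᴾ g = map (a *_) g +ᴾ (0# ∷ (f *ᴾ g))

  const : Carrier → Poly
  const a = a ∷ []

  X : Poly
  X = 0# ∷ 1# ∷ []

  rawRing : RawRing c ℓ
  rawRing = record
    { Carrier = Poly
    ; _≈_     = _≈ᴾ_
    ; _+_     = _+ᴾ_
    ; _*_     = _*ᴾ_
    ; -_      = map -_
    ; 0#      = []
    ; 1#      = const 1#
    }

module Poly-q = Polynomial +-*-rawRing
module Poly-p = Polynomial Poly-q.rawRing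
module Poly-x = Polynomial Poly-p.rawRing

ℚ[q] ℚ[q][p] ℚ[q][p][x] : RawRing 0ℓ 0ℓ
ℚ[q]       = Poly-q.rawRing
ℚ[q][p]    = Poly-p.rawRing
ℚ[q][p][x] = Poly-x.rawRing

q : RawRing.Carrier ℚ[q]
q = Poly-q.X

fromℤ : ℤ → RawRing.Carrier ℚ[q]
fromℤ z = Poly-q.const (z / 1)

module _ where
  open RawRing ℚ[q][p] using (Carrier; _+_; 0#) renaming (_*_ to _·_)
  open RawSemiringDefs (RawRing.rawSemiring ℚ[q][p]) using () renaming (_^_ to _↑_)

  private
    p′ q′ : Carrier
    p′ = Poly-p.X
    q′ = Poly-p.const q

  -- The sequence starts at index 1; F 0 is a dummy value and is never used.
  F : ℕ → Carrier
  F 0                   = 0#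
  F 1                   = q′
  F 2                   = q′ ↑ 2
  F (suc (suc (suc m))) = (q′ · F (suc (suc m))) + (p′ · F (suc m))

module _ where
  open RawRing ℚ[q][p][x] using (Carrier; _+_; 1#) renaming (_*_ to _·_)

  -- x (x + F 1) ⋯ (x + F (k - 1))
  rising : Carrier → ℕ → Carrier
  rising x 0             = 1#
  rising x 1             = x
  rising x (suc (suc k)) = rising x (suc k) · (x + Poly-x.const (F (suc k)))

cf : ℕ → ℕ → RawRing.Carrier ℚ[q][p]
cf n k = Poly-x.coeff (rising Poly-x.X n) k

infix 9 _∣p^_

_∣p^_ : RawRing.Carrier ℚ[q][p] → ℕ → RawRing.Carrier ℚ[q]
f ∣p^ s = Poly-p.coeff f s

open RawRing ℚ[q] public using (_≈_; _*_; 0#)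
open RawSemiringDefs (RawRing.rawSemiring ℚ[q]) public using (_^_)

{-# OPTIONS --safe #-}

-- cf(n,1) is the product F₁ ⋯ Fₙ₋₁.  Substituting t = p / q² turns F_m into q^m F̂_m(t), where
-- F̂_m = Σₖ C(m−1−k, k) tᵏ has integer coefficients, so the coefficient of pˢ in cf(n,1) is
-- q^(C(n,2) − 2s) times the coefficient of tˢ in F̂₁ ⋯ F̂ₙ₋₁.  The latter obeys a recurrence
-- in n; products of binomial coefficients of m are linearised by
-- C(m,k) m = k C(m,k) + (k+1) C(m,k+1), and Pascal's rule then closes each induction.

module Submission where

open import Algebra.Bundles using (CommutativeRing)
open import Algebra.Bundles.Raw using (module RawRing)
open import Algebra.Morphism.Structures using (module SemiringMorphisms)
import Algebra.Properties.CommutativeSemigroup as CommutativeSemigroupProperties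
import Algebra.Properties.Ring as RingProperties
import Algebra.Properties.Semiring.Exp as Exp
open import Data.Integer as ℤ using (ℤ; +_; 0ℤ; 1ℤ)
import Data.Integer.Properties as ℤ
open import Data.Integer.Tactic.RingSolver using (solve-∀)
open import Data.List using ([]; _∷_; map)
open import Data.Nat as ℕ using (ℕ; zero; suc; _≤_; _∸_; z≤n; s≤s)
import Data.Nat.Properties as ℕ
open import Data.Nat.Combinatorics using (_C_; nC1≡n; nCk+nC[k+1]≡[n+1]C[k+1])
open import Data.Product using (_×_; _,_)
open import Data.Rational as ℚ using (_/_)
import Data.Rational.Properties as ℚ
open import Data.Rational.Unnormalised as ℚᵘ using (mkℚᵘ; *≡*)
import Data.Rational.Unnormalised.Properties as ℚᵘ
open import Defs hiding (_≈_; _*_; 0#; _^_)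
open import Function using (_∘_)
import Relation.Binary.Reasoning.Setoid as SetoidReasoning
open import Relation.Binary.PropositionalEquality as ≡ using (_≡_; cong; cong₂)

-- Cauchy products of coefficient sequences.

module Convolution {c ℓ} (R : CommutativeRing c ℓ) where

  open CommutativeRing R
  open SetoidReasoning setoid
  open CommutativeSemigroupProperties +-commutativeSemigroup using (interchange)

  -- Taken on sequences rather than lists, so that trailing zeros become invisible and the ring laws
  -- can be proved pointwise.
  conv : (ℕ → Carrier) → (ℕ → Carrier) → ℕ → Carrier
  conv a b zero    = a 0 * b 0
  conv a b (suc k) = a 0 * b (suc k) + conv (a ∘ suc) b k

  conv-cong : ∀ {a a′ b b′} → (∀ k → a k ≈ a′ k) → (∀ k → b k ≈ b′ k) →
              ∀ k → conv a b k ≈ conv a′ b′ k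
  conv-cong a≈ b≈ zero    = *-cong (a≈ 0) (b≈ 0)
  conv-cong a≈ b≈ (suc k) =
    +-cong (*-cong (a≈ 0) (b≈ (suc k))) (conv-cong (a≈ ∘ suc) b≈ k)

  -- The definition peels the first factor; peeling the second one as well is what makes the
  -- induction for commutativity close.
  conv-unfoldʳ : ∀ a b k → conv a b (suc k) ≈ a (suc k) * b 0 + conv a (b ∘ suc) k
  conv-unfoldʳ a b zero    = +-comm _ _
  conv-unfoldʳ a b (suc k) = begin
    a 0 * b (suc (suc k)) + conv (a ∘ suc) b (suc k)
      ≈⟨ +-congˡ (conv-unfoldʳ (a ∘ suc) b k) ⟩
    a 0 * b (suc (suc k)) + (a (suc (suc k)) * b 0 + conv (a ∘ suc) (b ∘ suc) k)
      ≈⟨ +-assoc _ _ _ ⟨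
    a 0 * b (suc (suc k)) + a (suc (suc k)) * b 0 + conv (a ∘ suc) (b ∘ suc) k
      ≈⟨ +-congʳ (+-comm _ _) ⟩
    a (suc (suc k)) * b 0 + a 0 * b (suc (suc k)) + conv (a ∘ suc) (b ∘ suc) k
      ≈⟨ +-assoc _ _ _ ⟩
    a (suc (suc k)) * b 0 + conv a (b ∘ suc) (suc k) ∎

  conv-comm : ∀ a b k → conv a b k ≈ conv b a k
  conv-comm a b zero    = *-comm _ _
  conv-comm a b (suc k) = begin
    a 0 * b (suc k) + conv (a ∘ suc) b k
      ≈⟨ +-cong (*-comm _ _) (conv-comm (a ∘ suc) b k) ⟩
    b (suc k) * a 0 + conv b (a ∘ suc) k
      ≈⟨ conv-unfoldʳ b a k ⟨
    conv b a (suc k) ∎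

  conv-distribʳ : ∀ a b d k → conv (λ j → a j + b j) d k ≈ conv a d k + conv b d k
  conv-distribʳ a b d zero    = distribʳ _ _ _
  conv-distribʳ a b d (suc k) =
    trans (+-cong (distribʳ _ _ _) (conv-distribʳ (a ∘ suc) (b ∘ suc) d k)) (interchange _ _ _ _)

  conv-scaleˡ : ∀ x a b k → conv (λ j → x * a j) b k ≈ x * conv a b k
  conv-scaleˡ x a b zero    = *-assoc _ _ _
  conv-scaleˡ x a b (suc k) =
    trans (+-cong (*-assoc _ _ _) (conv-scaleˡ x (a ∘ suc) b k)) (sym (distribˡ _ _ _))

  conv-zeroˡ : ∀ {a} b → (∀ k → a k ≈ 0#) → ∀ k → conv a b k ≈ 0#
  conv-zeroˡ b a≈0 zero    = trans (*-congʳ (a≈0 0)) (zeroˡ _)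
  conv-zeroˡ b a≈0 (suc k) =
    trans (+-cong (trans (*-congʳ (a≈0 0)) (zeroˡ _)) (conv-zeroˡ b (a≈0 ∘ suc) k)) (+-identityˡ _)

  -- The tail of `conv a b` is by definition a multiple of the tail of `b` plus a convolution with
  -- the tail of `a`; linearity in the first argument splits the two.
  conv-assoc : ∀ a b d k → conv (conv a b) d k ≈ conv a (conv b d) k
  conv-assoc a b d zero    = *-assoc _ _ _
  conv-assoc a b d (suc k) = begin
    a 0 * b 0 * d (suc k) + conv (λ j → a 0 * b (suc j) + conv (a ∘ suc) b j) d k
      ≈⟨ +-cong (*-assoc _ _ _) (conv-distribʳ (λ j → a 0 * b (suc j)) (conv (a ∘ suc) b) d k) ⟩
    a 0 * (b 0 * d (suc k)) + (conv (λ j → a 0 * b (suc j)) d k + conv (conv (a ∘ suc) b) d k)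
      ≈⟨ +-congˡ (+-cong (conv-scaleˡ (a 0) (b ∘ suc) d k) (conv-assoc (a ∘ suc) b d k)) ⟩
    a 0 * (b 0 * d (suc k)) + (a 0 * conv (b ∘ suc) d k + conv (a ∘ suc) (conv b d) k)
      ≈⟨ +-assoc _ _ _ ⟨
    a 0 * (b 0 * d (suc k)) + a 0 * conv (b ∘ suc) d k + conv (a ∘ suc) (conv b d) k
      ≈⟨ +-congʳ (distribˡ _ _ _) ⟨
    a 0 * conv b d (suc k) + conv (a ∘ suc) (conv b d) k ∎

-- The commutative ring of polynomials, with laws checked coefficientwise.

module PolynomialRing {c ℓ} (R : CommutativeRing c ℓ) where

  open CommutativeRing R
  open SetoidReasoning setoid
  open Convolution R public
  open Polynomial rawRing using (Poly; coeff; _≈ᴾ_; _+ᴾ_; _*ᴾ_; const; X)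
  open RingProperties ring using (-0#≈0#)

  coeff-+ : ∀ f g k → coeff (f +ᴾ g) k ≈ coeff f k + coeff g k
  coeff-+ []      g       k       = sym (+-identityˡ _)
  coeff-+ (a ∷ f) []      k       = sym (+-identityʳ _)
  coeff-+ (a ∷ f) (b ∷ g) zero    = refl
  coeff-+ (a ∷ f) (b ∷ g) (suc k) = coeff-+ f g k

  coeff-scale : ∀ a f k → coeff (map (a *_) f) k ≈ a * coeff f k
  coeff-scale a []      k       = sym (zeroʳ a)
  coeff-scale a (b ∷ f) zero    = refl
  coeff-scale a (b ∷ f) (suc k) = coeff-scale a f k

  coeff-neg : ∀ f k → coeff (map -_ f) k ≈ - coeff f k
  coeff-neg []      k       = sym -0#≈0#
  coeff-neg (b ∷ f) zero    = refl
  coeff-neg (b ∷ f) (suc k) = coeff-neg f k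

  -- The bridge through which every multiplicative law is transferred from `conv` to lists.
  coeff-* : ∀ f g k → coeff (f *ᴾ g) k ≈ conv (coeff f) (coeff g) k
  coeff-* []      g k       = sym (conv-zeroˡ (coeff g) (λ _ → refl) k)
  coeff-* (a ∷ f) g zero    = begin
    coeff (map (a *_) g +ᴾ (0# ∷ (f *ᴾ g))) 0  ≈⟨ coeff-+ (map (a *_) g) _ 0 ⟩
    coeff (map (a *_) g) 0 + 0#                ≈⟨ +-identityʳ _ ⟩
    coeff (map (a *_) g) 0                     ≈⟨ coeff-scale a g 0 ⟩
    a * coeff g 0                              ∎
  coeff-* (a ∷ f) g (suc k) = begin
    coeff (map (a *_) g +ᴾ (0# ∷ (f *ᴾ g))) (suc k)    ≈⟨ coeff-+ (map (a *_) g) _ (suc k) ⟩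
    coeff (map (a *_) g) (suc k) + coeff (f *ᴾ g) k    ≈⟨ +-cong (coeff-scale a g (suc k)) (coeff-* f g k) ⟩
    a * coeff g (suc k) + conv (coeff f) (coeff g) k   ∎

  conv-identityˡ : ∀ b k → conv (coeff (const 1#)) b k ≈ b k
  conv-identityˡ b zero    = *-identityˡ _
  conv-identityˡ b (suc k) =
    trans (+-cong (*-identityˡ _) (conv-zeroˡ b (λ _ → refl) k)) (+-identityʳ _)

  coeff-X* : ∀ f k → coeff (X *ᴾ f) (suc k) ≈ coeff f k
  coeff-X* f k = begin
    coeff (X *ᴾ f) (suc k)                                   ≈⟨ coeff-* X f (suc k) ⟩
    0# * coeff f (suc k) + conv (coeff (const 1#)) (coeff f) k  ≈⟨ +-cong (zeroˡ _) (conv-identityˡ (coeff f) k) ⟩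
    0# + coeff f k                                           ≈⟨ +-identityˡ _ ⟩
    coeff f k                                                ∎

  -- Multiplication by `X` shifts the coefficients, hence is injective. With `X` read as `q`, this
  -- later permits division by powers of `q`.
  X*-cancelˡ : ∀ f g → (X *ᴾ f) ≈ᴾ (X *ᴾ g) → f ≈ᴾ g
  X*-cancelˡ f g Xf≈Xg k = begin
    coeff f k               ≈⟨ coeff-X* f k ⟨
    coeff (X *ᴾ f) (suc k)  ≈⟨ Xf≈Xg (suc k) ⟩
    coeff (X *ᴾ g) (suc k)  ≈⟨ coeff-X* g k ⟩
    coeff g k               ∎

  private
    +ᴾ-from : ∀ {f f′ g g′} k → coeff f k + coeff g k ≈ coeff f′ k + coeff g′ k →
              coeff (f +ᴾ g) k ≈ coeff (f′ +ᴾ g′) k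
    +ᴾ-from {f} {f′} {g} {g′} k eq = trans (coeff-+ f g k) (trans eq (sym (coeff-+ f′ g′ k)))

    +ᴾ-assoc : ∀ f g h → ((f +ᴾ g) +ᴾ h) ≈ᴾ (f +ᴾ (g +ᴾ h))
    +ᴾ-assoc f g h k = +ᴾ-from {f +ᴾ g} {f} {h} {g +ᴾ h} k (begin
      coeff (f +ᴾ g) k + coeff h k         ≈⟨ +-congʳ (coeff-+ f g k) ⟩
      coeff f k + coeff g k + coeff h k    ≈⟨ +-assoc _ _ _ ⟩
      coeff f k + (coeff g k + coeff h k)  ≈⟨ +-congˡ (coeff-+ g h k) ⟨
      coeff f k + coeff (g +ᴾ h) k         ∎)

    +ᴾ-identityʳ : ∀ f → (f +ᴾ []) ≈ᴾ f
    +ᴾ-identityʳ f k = trans (coeff-+ f [] k) (+-identityʳ _)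

    -ᴾ-inverseˡ : ∀ f → (map -_ f +ᴾ f) ≈ᴾ []
    -ᴾ-inverseˡ f k =
      trans (coeff-+ (map -_ f) f k) (trans (+-congʳ (coeff-neg f k)) (-‿inverseˡ _))

    -ᴾ-inverseʳ : ∀ f → (f +ᴾ map -_ f) ≈ᴾ []
    -ᴾ-inverseʳ f k =
      trans (coeff-+ f (map -_ f) k) (trans (+-congˡ (coeff-neg f k)) (-‿inverseʳ _))

    *ᴾ-cong : ∀ {f f′ g g′} → f ≈ᴾ f′ → g ≈ᴾ g′ → (f *ᴾ g) ≈ᴾ (f′ *ᴾ g′)
    *ᴾ-cong {f} {f′} {g} {g′} f≈ g≈ k =
      trans (coeff-* f g k) (trans (conv-cong f≈ g≈ k) (sym (coeff-* f′ g′ k)))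

    *ᴾ-comm : ∀ f g → (f *ᴾ g) ≈ᴾ (g *ᴾ f)
    *ᴾ-comm f g k = begin
      coeff (f *ᴾ g) k            ≈⟨ coeff-* f g k ⟩
      conv (coeff f) (coeff g) k  ≈⟨ conv-comm (coeff f) (coeff g) k ⟩
      conv (coeff g) (coeff f) k  ≈⟨ coeff-* g f k ⟨
      coeff (g *ᴾ f) k            ∎

    *ᴾ-assoc : ∀ f g h → ((f *ᴾ g) *ᴾ h) ≈ᴾ (f *ᴾ (g *ᴾ h))
    *ᴾ-assoc f g h k = begin
      coeff ((f *ᴾ g) *ᴾ h) k                       ≈⟨ coeff-* (f *ᴾ g) h k ⟩
      conv (coeff (f *ᴾ g)) (coeff h) k             ≈⟨ conv-cong (coeff-* f g) (λ _ → refl) k ⟩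
      conv (conv (coeff f) (coeff g)) (coeff h) k   ≈⟨ conv-assoc (coeff f) (coeff g) (coeff h) k ⟩
      conv (coeff f) (conv (coeff g) (coeff h)) k   ≈⟨ conv-cong (λ _ → refl) (coeff-* g h) k ⟨
      conv (coeff f) (coeff (g *ᴾ h)) k             ≈⟨ coeff-* f (g *ᴾ h) k ⟨
      coeff (f *ᴾ (g *ᴾ h)) k                       ∎

    *ᴾ-identityˡ : ∀ f → (const 1# *ᴾ f) ≈ᴾ f
    *ᴾ-identityˡ f k = trans (coeff-* (const 1#) f k) (conv-identityˡ (coeff f) k)

    *ᴾ-distribʳ : ∀ h f g → ((f +ᴾ g) *ᴾ h) ≈ᴾ ((f *ᴾ h) +ᴾ (g *ᴾ h))
    *ᴾ-distribʳ h f g k = begin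
      coeff ((f +ᴾ g) *ᴾ h) k                         ≈⟨ coeff-* (f +ᴾ g) h k ⟩
      conv (coeff (f +ᴾ g)) (coeff h) k               ≈⟨ conv-cong (coeff-+ f g) (λ _ → refl) k ⟩
      conv (λ j → coeff f j + coeff g j) (coeff h) k  ≈⟨ conv-distribʳ (coeff f) (coeff g) (coeff h) k ⟩
      conv (coeff f) (coeff h) k + conv (coeff g) (coeff h) k
                                                      ≈⟨ +-cong (coeff-* f h k) (coeff-* g h k) ⟨
      coeff (f *ᴾ h) k + coeff (g *ᴾ h) k             ≈⟨ coeff-+ (f *ᴾ h) (g *ᴾ h) k ⟨
      coeff ((f *ᴾ h) +ᴾ (g *ᴾ h)) k                  ∎

    *ᴾ-identityʳ : ∀ f → (f *ᴾ const 1#) ≈ᴾ f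
    *ᴾ-identityʳ f k = trans (*ᴾ-comm f (const 1#) k) (*ᴾ-identityˡ f k)

    *ᴾ-distribˡ : ∀ h f g → (h *ᴾ (f +ᴾ g)) ≈ᴾ ((h *ᴾ f) +ᴾ (h *ᴾ g))
    *ᴾ-distribˡ h f g k = begin
      coeff (h *ᴾ (f +ᴾ g)) k         ≈⟨ *ᴾ-comm h (f +ᴾ g) k ⟩
      coeff ((f +ᴾ g) *ᴾ h) k         ≈⟨ *ᴾ-distribʳ h f g k ⟩
      coeff ((f *ᴾ h) +ᴾ (g *ᴾ h)) k  ≈⟨ +ᴾ-from {f *ᴾ h} {h *ᴾ f} {g *ᴾ h} {h *ᴾ g} k
                                           (+-cong (*ᴾ-comm f h k) (*ᴾ-comm g h k)) ⟩
      coeff ((h *ᴾ f) +ᴾ (h *ᴾ g)) k  ∎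

  polynomialRing : CommutativeRing c ℓ
  polynomialRing = record
    { RawRing (Polynomial.rawRing rawRing)
    ; isCommutativeRing = record
      { isRing = record
        { +-isAbelianGroup = record
          { isGroup = record
            { isMonoid = record
              { isSemigroup = record
                { isMagma = record
                  { isEquivalence = record
                    { refl  = λ _ → refl
                    ; sym   = λ f≈g k → sym (f≈g k)
                    ; trans = λ f≈g g≈h k → trans (f≈g k) (g≈h k)
                    }
                  ; ∙-cong = λ {f} {f′} {g} {g′} f≈f′ g≈g′ k →
                      +ᴾ-from {f} {f′} {g} {g′} k (+-cong (f≈f′ k) (g≈g′ k))
                  }
                ; assoc = +ᴾ-assoc
                }
              ; identity = (λ _ _ → refl) , +ᴾ-identityʳ
              }
            ; inverse = -ᴾ-inverseˡ , -ᴾ-inverseʳ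
            ; ⁻¹-cong = λ {f} {g} f≈g k →
                trans (coeff-neg f k) (trans (-‿cong (f≈g k)) (sym (coeff-neg g k)))
            }
          ; comm = λ f g k → +ᴾ-from {f} {g} {g} {f} k (+-comm _ _)
          }
        ; *-cong = λ {f} {f′} {g} {g′} → *ᴾ-cong {f} {f′} {g} {g′}
        ; *-assoc = *ᴾ-assoc
        ; *-identity = *ᴾ-identityˡ , *ᴾ-identityʳ
        ; distrib = *ᴾ-distribˡ , *ᴾ-distribʳ
        }
      ; *-comm = *ᴾ-comm
      }
    }

module ℤ[t] where
  open Polynomial ℤ.+-*-rawRing public
  open PolynomialRing ℤ.+-*-commutativeRing public

-- The integer polynomials F̂ₘ(t) and the low coefficients of their products.

module ScaledCoefficients where

  open import Data.Integer using (_+_; _*_; _-_)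
  open ≡ using (refl; sym; trans)
  open ≡.≡-Reasoning
  open ℤ[t] using (Poly; coeff; _+ᴾ_; _*ᴾ_; const; X; coeff-+; coeff-*; coeff-X*)

  -- Binomial coefficients for which Pascal's rule holds definitionally, so that β (j + m) k
  -- unfolds to a sum of β m i and the ring solver can take over.
  β : ℕ → ℕ → ℤ
  β n       zero    = 1ℤ
  β zero    (suc k) = 0ℤ
  β (suc n) (suc k) = β n k + β n (suc k)

  β≡C : ∀ n k → β n k ≡ + (n C k)
  β≡C n       zero    = refl
  β≡C zero    (suc k) = refl
  β≡C (suc n) (suc k) = begin
    β n k + β n (suc k)        ≡⟨ cong₂ _+_ (β≡C n k) (β≡C n (suc k)) ⟩
    + (n C k) + + (n C suc k)  ≡⟨⟩
    + (n C k ℕ.+ n C suc k)    ≡⟨ cong +_ (nCk+nC[k+1]≡[n+1]C[k+1] n k) ⟩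
    + (suc n C suc k)          ∎

  -- The Fibonacci polynomials in t. Starting from 0 at index 0 makes index 2 an instance of the
  -- recurrence.
  F̂ : ℕ → Poly
  F̂ 0             = []
  F̂ 1             = const 1ℤ
  F̂ (suc (suc m)) = F̂ (suc m) +ᴾ (X *ᴾ F̂ m)

  coeff-F̂-suc : ∀ m k → coeff (F̂ (suc (suc m))) (suc k) ≡ coeff (F̂ (suc m)) (suc k) + coeff (F̂ m) k
  coeff-F̂-suc m k =
    trans (coeff-+ (F̂ (suc m)) (X *ᴾ F̂ m) (suc k))
      (cong (λ z → coeff (F̂ (suc m)) (suc k) + z) (coeff-X* (F̂ m) k))

  -- A crude degree bound, roughly twice the true degree, but enough for the boundary case `m = 0`
  -- of `coeff-F̂`.
  coeff-F̂≡0 : ∀ {m k} → m ℕ.≤ k → coeff (F̂ m) k ≡ 0ℤ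
  coeff-F̂≡0 {0}           {k}     _         = refl
  coeff-F̂≡0 {1}           {suc k} _         = refl
  coeff-F̂≡0 {suc (suc m)} {suc k} (ℕ.s≤s h) = trans (coeff-F̂-suc m k)
    (cong₂ _+_ (coeff-F̂≡0 (ℕ.m≤n⇒m≤1+n h)) (coeff-F̂≡0 (ℕ.<⇒≤ h)))

  -- Writing the index as `suc (k + m)` avoids truncated subtraction and turns the recurrence of
  -- `F̂` into Pascal's rule for `β`.
  coeff-F̂ : ∀ k m → coeff (F̂ (suc (k ℕ.+ m))) k ≡ β m k
  coeff-F̂ zero    zero    = refl
  coeff-F̂ zero    (suc m) = begin
    coeff (F̂ (suc (suc m))) 0                ≡⟨ coeff-+ (F̂ (suc m)) (X *ᴾ F̂ m) 0 ⟩
    coeff (F̂ (suc m)) 0 + coeff (X *ᴾ F̂ m) 0 ≡⟨ cong₂ _+_ (coeff-F̂ 0 m) (coeff-* X (F̂ m) 0) ⟩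
    1ℤ + 0ℤ * coeff (F̂ m) 0                  ≡⟨⟩
    1ℤ                                       ∎
  coeff-F̂ (suc k) zero rewrite ℕ.+-identityʳ k = trans (coeff-F̂-suc k k)
    (cong₂ _+_ (coeff-F̂≡0 {suc k} ℕ.≤-refl) (coeff-F̂≡0 {k} ℕ.≤-refl))
  coeff-F̂ (suc k) (suc m) = begin
    coeff (F̂ (suc (suc (k ℕ.+ suc m)))) (suc k)
      ≡⟨ coeff-F̂-suc (k ℕ.+ suc m) k ⟩
    coeff (F̂ (suc (k ℕ.+ suc m))) (suc k) + coeff (F̂ (k ℕ.+ suc m)) k
      ≡⟨ cong (λ j → coeff (F̂ (suc j)) (suc k) + coeff (F̂ j) k) (ℕ.+-suc k m) ⟩
    coeff (F̂ (suc (suc k ℕ.+ m))) (suc k) + coeff (F̂ (suc (k ℕ.+ m))) k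
      ≡⟨ cong₂ _+_ (coeff-F̂ (suc k) m) (coeff-F̂ k m) ⟩
    β m (suc k) + β m k
      ≡⟨ ℤ.+-comm (β m (suc k)) (β m k) ⟩
    β (suc m) (suc k) ∎

  -- The product F̂₁ ⋯ F̂ₙ, the counterpart of `cf (suc n) 1`: the indices differ by one.
  Ĝ : ℕ → Poly
  Ĝ 0       = const 1ℤ
  Ĝ (suc n) = Ĝ n *ᴾ F̂ (suc n)

  -- As `β m 1` is m, this splits m = k + (m - k) and uses (m - k) C(m,k) = (k + 1) C(m,k+1).
  β*β₁ : ∀ m k → β m k * β m 1 ≡ + k * β m k + + suc k * β m (suc k)
  β*β₁ m       zero    = isolate (β m 1)
    where
    isolate : ∀ b → 1ℤ * b ≡ 0ℤ * 1ℤ + 1ℤ * b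
    isolate = solve-∀
  β*β₁ zero    (suc k) = sym (cong₂ _+_ (ℤ.*-zeroʳ (+ suc k)) (ℤ.*-zeroʳ (+ suc (suc k))))
  β*β₁ (suc m) (suc k) = begin
    (x + y) * (1ℤ + b)       ≡⟨ expand x y b ⟩
    x + y + (x * b + y * b)  ≡⟨ cong (λ w → x + y + w) (cong₂ _+_ (β*β₁ m k) (β*β₁ m (suc k))) ⟩
    x + y + (+ k * x + + suc k * y + (+ suc k * y + + suc (suc k) * z))
                             ≡⟨ collect (+ k) x y z ⟩
    + suc k * (x + y) + + suc (suc k) * (y + z) ∎
    where
    b = β m 1
    x = β m k
    y = β m (suc k)
    z = β m (suc (suc k))
    expand : ∀ x y b → (x + y) * (1ℤ + b) ≡ x + y + (x * b + y * b)
    expand = solve-∀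
    -- `1ℤ + + k` computes to `+ suc k`, so the solver may treat `+ k` as a variable.
    collect : ∀ k x y z →
      x + y + (k * x + (1ℤ + k) * y + ((1ℤ + k) * y + (1ℤ + (1ℤ + k)) * z)) ≡
      (1ℤ + k) * (x + y) + (1ℤ + (1ℤ + k)) * (y + z)
    collect = solve-∀

  -- Ordered pairs of 2-subsets sorted by the size of their union: a union of size 2 arises from 1
  -- pair, of size 3 from 6, of size 4 from 6.
  β₂*β₂ : ∀ m → β m 2 * β m 2 ≡ β m 2 + + 6 * β m 3 + + 6 * β m 4
  β₂*β₂ zero    = refl
  β₂*β₂ (suc m) = begin
    (b₁ + b₂) * (b₁ + b₂)
      ≡⟨ expand b₁ b₂ ⟩
    b₁ * b₁ + + 2 * (b₂ * b₁) + b₂ * b₂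
      ≡⟨ cong₂ _+_ (cong₂ _+_ (β*β₁ m 1) (cong (+ 2 *_) (β*β₁ m 2))) (β₂*β₂ m) ⟩
    + 1 * b₁ + + 2 * b₂ + + 2 * (+ 2 * b₂ + + 3 * b₃) + (b₂ + + 6 * b₃ + + 6 * b₄)
      ≡⟨ collect b₁ b₂ b₃ b₄ ⟩
    b₁ + b₂ + + 6 * (b₂ + b₃) + + 6 * (b₃ + b₄) ∎
    where
    b₁ = β m 1
    b₂ = β m 2
    b₃ = β m 3
    b₄ = β m 4
    expand : ∀ b₁ b₂ → (b₁ + b₂) * (b₁ + b₂) ≡ b₁ * b₁ + + 2 * (b₂ * b₁) + b₂ * b₂
    expand = solve-∀
    collect : ∀ b₁ b₂ b₃ b₄ →
      + 1 * b₁ + + 2 * b₂ + + 2 * (+ 2 * b₂ + + 3 * b₃) + (b₂ + + 6 * b₃ + + 6 * b₄) ≡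
      b₁ + b₂ + + 6 * (b₂ + b₃) + + 6 * (b₃ + b₄)
    collect = solve-∀

  coeff₀-Ĝ : ∀ n → coeff (Ĝ n) 0 ≡ 1ℤ
  coeff₀-Ĝ zero    = refl
  coeff₀-Ĝ (suc n) = trans (coeff-* (Ĝ n) (F̂ (suc n)) 0) (cong₂ _*_ (coeff₀-Ĝ n) (coeff-F̂ 0 n))

  -- All constant terms are 1, so each new factor adds just its own linear coefficient `β m 1`.
  coeff₁-Ĝ : ∀ m → coeff (Ĝ (1 ℕ.+ m)) 1 ≡ β m 2
  coeff₁-Ĝ zero    = refl
  coeff₁-Ĝ (suc m) = begin
    coeff (Ĝ (2 ℕ.+ m)) 1
      ≡⟨ coeff-* (Ĝ (1 ℕ.+ m)) (F̂ (2 ℕ.+ m)) 1 ⟩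
    coeff (Ĝ (1 ℕ.+ m)) 0 * coeff (F̂ (2 ℕ.+ m)) 1 + coeff (Ĝ (1 ℕ.+ m)) 1 * coeff (F̂ (2 ℕ.+ m)) 0
      ≡⟨ cong₂ _+_ (cong₂ _*_ (coeff₀-Ĝ (1 ℕ.+ m)) (coeff-F̂ 1 m))
                   (cong₂ _*_ (coeff₁-Ĝ m) (coeff-F̂ 0 (suc m))) ⟩
    1ℤ * β m 1 + β m 2 * 1ℤ
      ≡⟨ cong₂ _+_ (ℤ.*-identityˡ (β m 1)) (ℤ.*-identityʳ (β m 2)) ⟩
    β m 1 + β m 2 ∎

  -- The new factor adds C(m,2) when it contributes t², and C(m+1,2) · C(m+1,1) when it and the old
  -- product contribute t each.
  coeff₂-Ĝ : ∀ m → coeff (Ĝ (2 ℕ.+ m)) 2 ≡ + 3 * β (2 ℕ.+ m) 4 - β m 2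
  coeff₂-Ĝ zero    = refl
  coeff₂-Ĝ (suc m) = begin
    coeff (Ĝ (3 ℕ.+ m)) 2
      ≡⟨ coeff-* (Ĝ (2 ℕ.+ m)) (F̂ (3 ℕ.+ m)) 2 ⟩
    coeff (Ĝ (2 ℕ.+ m)) 0 * coeff (F̂ (3 ℕ.+ m)) 2 +
      (coeff (Ĝ (2 ℕ.+ m)) 1 * coeff (F̂ (3 ℕ.+ m)) 1 + coeff (Ĝ (2 ℕ.+ m)) 2 * coeff (F̂ (3 ℕ.+ m)) 0)
      ≡⟨ cong₂ _+_ (cong₂ _*_ (coeff₀-Ĝ (2 ℕ.+ m)) (coeff-F̂ 2 m))
        (cong₂ _+_ (cong₂ _*_ (coeff₁-Ĝ (1 ℕ.+ m)) (coeff-F̂ 1 (1 ℕ.+ m)))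
                   (cong₂ _*_ (coeff₂-Ĝ m) (coeff-F̂ 0 (2 ℕ.+ m)))) ⟩
    1ℤ * b₂ + (β (1 ℕ.+ m) 2 * β (1 ℕ.+ m) 1 + (+ 3 * β (2 ℕ.+ m) 4 - b₂) * 1ℤ)
      ≡⟨ cong (λ z → 1ℤ * b₂ + (z + (+ 3 * β (2 ℕ.+ m) 4 - b₂) * 1ℤ)) (β*β₁ (1 ℕ.+ m) 2) ⟩
    1ℤ * b₂ + (+ 2 * β (1 ℕ.+ m) 2 + + 3 * β (1 ℕ.+ m) 3 + (+ 3 * β (2 ℕ.+ m) 4 - b₂) * 1ℤ)
      ≡⟨ collect b₁ b₂ b₃ b₄ ⟩
    + 3 * β (3 ℕ.+ m) 4 - β (suc m) 2 ∎
    where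
    b₁ = β m 1
    b₂ = β m 2
    b₃ = β m 3
    b₄ = β m 4
    -- Each `β (j + m) i` appears in its Pascal unfolding, so both sides agree definitionally with
    -- the terms of the chain.
    collect : ∀ b₁ b₂ b₃ b₄ →
      1ℤ * b₂ + (+ 2 * (b₁ + b₂) + + 3 * (b₂ + b₃) + (+ 3 * (b₂ + b₃ + (b₃ + b₄)) - b₂) * 1ℤ) ≡
      + 3 * (b₁ + b₂ + (b₂ + b₃) + (b₂ + b₃ + (b₃ + b₄))) - (b₁ + b₂)
    collect = solve-∀

  -- The new factor contributes t³, t² or t against the coefficient 0, 1 or 2 of the old product.
  -- The offset 3 lets the induction start where both sides vanish.
  coeff₃-Ĝ : ∀ m → coeff (Ĝ (3 ℕ.+ m)) 3 ≡ + 15 * β (4 ℕ.+ m) 6 - + 6 * β (2 ℕ.+ m) 4 + β m 4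
  coeff₃-Ĝ zero    = refl
  coeff₃-Ĝ (suc m) = begin
    coeff (Ĝ (4 ℕ.+ m)) 3
      ≡⟨ coeff-* (Ĝ (3 ℕ.+ m)) (F̂ (4 ℕ.+ m)) 3 ⟩
    coeff (Ĝ (3 ℕ.+ m)) 0 * coeff (F̂ (4 ℕ.+ m)) 3 +
      (coeff (Ĝ (3 ℕ.+ m)) 1 * coeff (F̂ (4 ℕ.+ m)) 2 +
        (coeff (Ĝ (3 ℕ.+ m)) 2 * coeff (F̂ (4 ℕ.+ m)) 1 + coeff (Ĝ (3 ℕ.+ m)) 3 * coeff (F̂ (4 ℕ.+ m)) 0))
      ≡⟨ cong₂ _+_ (cong₂ _*_ (coeff₀-Ĝ (3 ℕ.+ m)) (coeff-F̂ 3 m))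
        (cong₂ _+_ (cong₂ _*_ (coeff₁-Ĝ (2 ℕ.+ m)) (coeff-F̂ 2 (1 ℕ.+ m)))
        (cong₂ _+_ (cong₂ _*_ (coeff₂-Ĝ (1 ℕ.+ m)) (coeff-F̂ 1 (2 ℕ.+ m)))
                   (cong₂ _*_ (coeff₃-Ĝ m) (coeff-F̂ 0 (3 ℕ.+ m))))) ⟩
    1ℤ * b₃ + (β (2 ℕ.+ m) 2 * β (1 ℕ.+ m) 2 +
      ((+ 3 * β (3 ℕ.+ m) 4 - β (1 ℕ.+ m) 2) * β (2 ℕ.+ m) 1 + G₃ * 1ℤ))
      ≡⟨ expand b₁ b₂ b₃ b₄ G₃ ⟩
    L + + 4 * (b₁ * b₁) + + 11 * (b₂ * b₁) + + 9 * (b₃ * b₁) + + 3 * (b₄ * b₁) + b₂ * b₂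
      ≡⟨ cong₂ _+_ (cong₂ _+_ (cong₂ _+_ (cong₂ _+_
           (cong (λ z → L + + 4 * z) (β*β₁ m 1))
           (cong (+ 11 *_) (β*β₁ m 2)))
           (cong (+ 9 *_) (β*β₁ m 3)))
           (cong (+ 3 *_) (β*β₁ m 4)))
           (β₂*β₂ m) ⟩
    L + + 4 * (+ 1 * b₁ + + 2 * b₂) + + 11 * (+ 2 * b₂ + + 3 * b₃) + + 9 * (+ 3 * b₃ + + 4 * b₄) +
      + 3 * (+ 4 * b₄ + + 5 * b₅) + (b₂ + + 6 * b₃ + + 6 * b₄)
      ≡⟨ collect b₁ b₂ b₃ b₄ b₅ b₆ ⟩
    + 15 * β (5 ℕ.+ m) 6 - + 6 * β (3 ℕ.+ m) 4 + β (suc m) 4 ∎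
    where
    b₁ = β m 1
    b₂ = β m 2
    b₃ = β m 3
    b₄ = β m 4
    b₅ = β m 5
    b₆ = β m 6
    G₃ = + 15 * β (4 ℕ.+ m) 6 - + 6 * β (2 ℕ.+ m) 4 + β m 4
    -- The part linear in the `β m i`, set apart so that every remaining monomial is a product which
    -- `β*β₁` or `β₂*β₂` linearises.
    L = G₃ + (+ 5 * b₁ + + 17 * b₂ + + 19 * b₃ + + 6 * b₄)
    expand : ∀ b₁ b₂ b₃ b₄ G₃ →
      1ℤ * b₃ + ((1ℤ + b₁ + (b₁ + b₂)) * (b₁ + b₂) +
        ((+ 3 * (b₁ + b₂ + (b₂ + b₃) + (b₂ + b₃ + (b₃ + b₄))) - (b₁ + b₂)) *
          (1ℤ + (1ℤ + b₁)) + G₃ * 1ℤ)) ≡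
      G₃ + (+ 5 * b₁ + + 17 * b₂ + + 19 * b₃ + + 6 * b₄) +
        + 4 * (b₁ * b₁) + + 11 * (b₂ * b₁) + + 9 * (b₃ * b₁) + + 3 * (b₄ * b₁) + b₂ * b₂
    expand = solve-∀
    collect : ∀ b₁ b₂ b₃ b₄ b₅ b₆ →
      + 15 * (b₂ + b₃ + (b₃ + b₄) + (b₃ + b₄ + (b₄ + b₅)) + (b₃ + b₄ + (b₄ + b₅) + (b₄ + b₅ + (b₅ + b₆)))) -
        + 6 * (b₂ + b₃ + (b₃ + b₄)) + b₄ +
        (+ 5 * b₁ + + 17 * b₂ + + 19 * b₃ + + 6 * b₄) +
        + 4 * (+ 1 * b₁ + + 2 * b₂) + + 11 * (+ 2 * b₂ + + 3 * b₃) + + 9 * (+ 3 * b₃ + + 4 * b₄) +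
        + 3 * (+ 4 * b₄ + + 5 * b₅) + (b₂ + + 6 * b₃ + + 6 * b₄) ≡
      + 15 * (b₁ + b₂ + (b₂ + b₃) + (b₂ + b₃ + (b₃ + b₄)) + (b₂ + b₃ + (b₃ + b₄) + (b₃ + b₄ + (b₄ + b₅))) +
          (b₂ + b₃ + (b₃ + b₄) + (b₃ + b₄ + (b₄ + b₅)) + (b₃ + b₄ + (b₄ + b₅) + (b₄ + b₅ + (b₅ + b₆))))) -
        + 6 * (b₁ + b₂ + (b₂ + b₃) + (b₂ + b₃ + (b₃ + b₄))) + (b₃ + b₄)
    collect = solve-∀

-- Weighted homogeneity: transfer between polynomials in p over `S` and integer polynomials in t = p
-- / x².

module Scaling {c ℓ} (S : CommutativeRing c ℓ)
  (ι : ℤ → CommutativeRing.Carrier S)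
  (ι-homo : SemiringMorphisms.IsSemiringHomomorphism ℤ.+-*-rawSemiring
    (RawRing.rawSemiring (CommutativeRing.rawRing S)) ι)
  (x : CommutativeRing.Carrier S) where

  open CommutativeRing S
  open SetoidReasoning setoid
  open CommutativeSemigroupProperties *-commutativeSemigroup using (interchange; x∙yz≈y∙xz)
  open Exp semiring using (_^_; ^-homo-*; ^-assocʳ)
  open PolynomialRing S
  open Polynomial rawRing using (coeff; _+ᴾ_; _*ᴾ_; const; X)
  open ScaledCoefficients using (F̂)
  open SemiringMorphisms.IsSemiringHomomorphism ι-homo
    renaming (+-homo to ι-+; *-homo to ι-*; 0#-homo to ι-0; 1#-homo to ι-1)

  private
    Q : Carrier
    Q = x ^ 2

  -- a ∼[ δ ] u says Σ aₛ pˢ = δ · u(p / x²), with denominators cleared.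
  _∼[_]_ : (ℕ → Carrier) → Carrier → (ℕ → ℤ) → Set ℓ
  a ∼[ δ ] u = ∀ s → a s * Q ^ s ≈ ι (u s) * δ

  ∼-resp : ∀ {a b δ ε u v} → (∀ s → a s ≈ b s) → δ ≈ ε → (∀ s → u s ≡ v s) →
           a ∼[ δ ] u → b ∼[ ε ] v
  ∼-resp {a} {b} {δ} {ε} {u} {v} a≈b δ≈ε u≡v a∼u s = begin
    b s * Q ^ s  ≈⟨ *-congʳ (a≈b s) ⟨
    a s * Q ^ s  ≈⟨ a∼u s ⟩
    ι (u s) * δ  ≈⟨ *-cong (reflexive (cong ι (u≡v s))) δ≈ε ⟩
    ι (v s) * ε  ∎

  ∼-+ : ∀ {a b δ u v} → a ∼[ δ ] u → b ∼[ δ ] v →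
        (λ s → a s + b s) ∼[ δ ] (λ s → u s ℤ.+ v s)
  ∼-+ {a} {b} {δ} {u} {v} a∼u b∼v s = begin
    (a s + b s) * Q ^ s           ≈⟨ distribʳ _ _ _ ⟩
    a s * Q ^ s + b s * Q ^ s     ≈⟨ +-cong (a∼u s) (b∼v s) ⟩
    ι (u s) * δ + ι (v s) * δ     ≈⟨ distribʳ _ _ _ ⟨
    (ι (u s) + ι (v s)) * δ       ≈⟨ *-congʳ (ι-+ _ _) ⟨
    ι (u s ℤ.+ v s) * δ           ∎

  -- Weights multiply. In the inductive step one factor `Q` moves into the tail of `a`, which
  -- restores the relation for the shifted sequence.
  ∼-conv : ∀ {a b δ ε u v} → a ∼[ δ ] u → b ∼[ ε ] v →
           conv a b ∼[ δ * ε ] ℤ[t].conv u v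
  ∼-conv {a} {b} {δ} {ε} {u} {v} a∼u b∼v = go
    where
    head : ∀ s → a 0 * b s * Q ^ s ≈ ι (u 0 ℤ.* v s) * (δ * ε)
    head s = begin
      a 0 * b s * Q ^ s              ≈⟨ *-assoc _ _ _ ⟩
      a 0 * (b s * Q ^ s)            ≈⟨ *-congʳ (*-identityʳ _) ⟨
      -- The inserted `1#` is `Q ^ 0`, as `a∼u 0` requires.
      a 0 * 1# * (b s * Q ^ s)       ≈⟨ *-cong (a∼u 0) (b∼v s) ⟩
      ι (u 0) * δ * (ι (v s) * ε)    ≈⟨ interchange _ _ _ _ ⟩
      ι (u 0) * ι (v s) * (δ * ε)    ≈⟨ *-congʳ (ι-* _ _) ⟨
      ι (u 0 ℤ.* v s) * (δ * ε)      ∎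

    go : conv a b ∼[ δ * ε ] ℤ[t].conv u v
    go zero    = head 0
    go (suc s) = begin
      (a 0 * b (suc s) + conv (a ∘ suc) b s) * Q ^ suc s
        ≈⟨ distribʳ _ _ _ ⟩
      a 0 * b (suc s) * Q ^ suc s + conv (a ∘ suc) b s * (Q * Q ^ s)
        ≈⟨ +-cong (head (suc s)) (sym (*-assoc _ _ _)) ⟩
      ι (u 0 ℤ.* v (suc s)) * (δ * ε) + conv (a ∘ suc) b s * Q * Q ^ s
        ≈⟨ +-congˡ (*-congʳ (trans (*-comm _ _) (sym (conv-scaleˡ Q (a ∘ suc) b s)))) ⟩
      ι (u 0 ℤ.* v (suc s)) * (δ * ε) + conv (λ j → Q * a (suc j)) b s * Q ^ s
        ≈⟨ +-congˡ (∼-conv {a = λ j → Q * a (suc j)} {u = u ∘ suc} shifted b∼v s) ⟩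
      ι (u 0 ℤ.* v (suc s)) * (δ * ε) + ι (ℤ[t].conv (u ∘ suc) v s) * (δ * ε)
        ≈⟨ distribʳ _ _ _ ⟨
      (ι (u 0 ℤ.* v (suc s)) + ι (ℤ[t].conv (u ∘ suc) v s)) * (δ * ε)
        ≈⟨ *-congʳ (ι-+ _ _) ⟨
      ι (u 0 ℤ.* v (suc s) ℤ.+ ℤ[t].conv (u ∘ suc) v s) * (δ * ε) ∎
      where
      shifted : (λ j → Q * a (suc j)) ∼[ δ ] (u ∘ suc)
      shifted j = begin
        Q * a (suc j) * Q ^ j    ≈⟨ *-congʳ (*-comm _ _) ⟩
        a (suc j) * Q * Q ^ j    ≈⟨ *-assoc _ _ _ ⟩
        a (suc j) * Q ^ suc j    ≈⟨ a∼u (suc j) ⟩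
        ι (u (suc j)) * δ        ∎

  ∼-0 : ∀ δ s → 0# * Q ^ s ≈ ι 0ℤ * δ
  ∼-0 δ s = trans (zeroˡ _) (sym (trans (*-congʳ ι-0) (zeroˡ δ)))

  -- The bound `x` shadows the module parameter: any scalar serves as its own weight, and 1 is used
  -- in this way too.
  ∼-const : ∀ x → coeff (const x) ∼[ x ] ℤ[t].coeff (ℤ[t].const 1ℤ)
  ∼-const x zero    = trans (*-comm _ _) (*-congʳ (sym ι-1))
  ∼-const x (suc s) = ∼-0 x (suc s)

  -- This is the substitution p = x² t.
  ∼-X : coeff X ∼[ Q ] ℤ[t].coeff ℤ[t].X
  ∼-X zero          = ∼-0 Q 0
  ∼-X (suc zero)    = *-cong (sym ι-1) (*-identityʳ Q)
  ∼-X (suc (suc s)) = ∼-0 Q (suc (suc s))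

  ∼-+ᴾ : ∀ {f g δ u v} → coeff f ∼[ δ ] ℤ[t].coeff u → coeff g ∼[ δ ] ℤ[t].coeff v →
         coeff (f +ᴾ g) ∼[ δ ] ℤ[t].coeff (u ℤ[t].+ᴾ v)
  ∼-+ᴾ {f} {g} {u = u} {v = v} f∼u g∼v =
    ∼-resp (sym ∘ coeff-+ f g) refl (≡.sym ∘ ℤ[t].coeff-+ u v)
      (∼-+ {a = coeff f} {b = coeff g} {u = ℤ[t].coeff u} {v = ℤ[t].coeff v} f∼u g∼v)

  ∼-*ᴾ : ∀ {f g δ ε u v} → coeff f ∼[ δ ] ℤ[t].coeff u → coeff g ∼[ ε ] ℤ[t].coeff v →
         coeff (f *ᴾ g) ∼[ δ * ε ] ℤ[t].coeff (u ℤ[t].*ᴾ v)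
  ∼-*ᴾ {f} {g} {u = u} {v = v} f∼u g∼v =
    ∼-resp (sym ∘ coeff-* f g) refl (≡.sym ∘ ℤ[t].coeff-* u v)
      (∼-conv {a = coeff f} {b = coeff g} {u = ℤ[t].coeff u} {v = ℤ[t].coeff v} f∼u g∼v)

  F₁∼F̂₁ : coeff (const x) ∼[ x ^ 1 ] ℤ[t].coeff (F̂ 1)
  F₁∼F̂₁ = ∼-resp {a = coeff (const x)} {u = ℤ[t].coeff (F̂ 1)} 
    (λ _ → refl) (sym (*-identityʳ x)) (λ _ → ≡.refl) (∼-const x)

  -- The left-hand side is the unfolded square by which `F 2` is defined.
  F₂∼F̂₂ : coeff (const x *ᴾ (const x *ᴾ const 1#)) ∼[ x ^ 2 ] ℤ[t].coeff (F̂ 2)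
  F₂∼F̂₂ = ∼-resp (λ _ → refl) refl 1*[1*1]≡F̂₂
    (∼-*ᴾ {const x} {const x *ᴾ const 1#} {u = 𝟙} {v = 𝟙 ℤ[t].*ᴾ 𝟙} (∼-const x)
      (∼-*ᴾ {const x} {const 1#} {u = 𝟙} {v = 𝟙} (∼-const x) (∼-const 1#)))
    where
    𝟙 : ℤ[t].Poly
    𝟙 = ℤ[t].const 1ℤ

    1*[1*1]≡F̂₂ : ∀ s → ℤ[t].coeff (𝟙 ℤ[t].*ᴾ (𝟙 ℤ[t].*ᴾ 𝟙)) s ≡ ℤ[t].coeff (F̂ 2) s
    1*[1*1]≡F̂₂ zero                = ≡.refl
    1*[1*1]≡F̂₂ (suc zero)          = ≡.refl
    1*[1*1]≡F̂₂ (suc (suc zero))    = ≡.refl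
    1*[1*1]≡F̂₂ (suc (suc (suc s))) = ≡.refl

  -- The recurrence is homogeneous: x · x^(m+1) and x² · x^m are the same weight, so the two
  -- summands may be added.
  F∼F̂-step : ∀ {f g} m → coeff f ∼[ x ^ suc m ] ℤ[t].coeff (F̂ (suc m)) →
             coeff g ∼[ x ^ m ] ℤ[t].coeff (F̂ m) →
             coeff ((const x *ᴾ f) +ᴾ (X *ᴾ g)) ∼[ x ^ suc (suc m) ] ℤ[t].coeff (F̂ (suc (suc m)))
  F∼F̂-step {f} {g} m f∼ g∼ =
    ∼-+ᴾ {const x *ᴾ f} {X *ᴾ g} {u = F̂ (suc m)} {v = ℤ[t].X ℤ[t].*ᴾ F̂ m}
      (∼-resp (λ _ → refl) refl
        (CommutativeRing.*-identityˡ ℤ[t].polynomialRing (F̂ (suc m)))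
        (∼-*ᴾ {const x} {f} {u = ℤ[t].const 1ℤ} {v = F̂ (suc m)} (∼-const x) f∼))
      (∼-resp (λ _ → refl)
        (trans (*-congʳ (*-congˡ (*-identityʳ x))) (*-assoc x x (x ^ m)))
        (λ _ → ≡.refl)
        (∼-*ᴾ {X} {g} {u = ℤ[t].X} {v = F̂ m} ∼-X g∼))

  module _ (x*-cancelˡ : ∀ a b → x * a ≈ x * b → a ≈ b) where

    *x^-cancelʳ : ∀ a b n → a * x ^ n ≈ b * x ^ n → a ≈ b
    *x^-cancelʳ a b zero    eq = trans (sym (*-identityʳ a)) (trans eq (*-identityʳ b))
    *x^-cancelʳ a b (suc n) eq = *x^-cancelʳ a b n (x*-cancelˡ _ _ (begin
      x * (a * x ^ n)  ≈⟨ x∙yz≈y∙xz x a (x ^ n) ⟩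
      a * x ^ suc n    ≈⟨ eq ⟩
      b * x ^ suc n    ≈⟨ x∙yz≈y∙xz x b (x ^ n) ⟨
      x * (b * x ^ n)  ∎))

    -- Cancels `Q ^ s`, that is x^(2s); the bound makes `d ∸ 2 ℕ.* s` a true difference.
    ∼⇒≈ : ∀ {a u d} → a ∼[ x ^ d ] u → ∀ s → 2 ℕ.* s ≤ d → a s ≈ ι (u s) * x ^ (d ∸ 2 ℕ.* s)
    ∼⇒≈ {a} {u} {d} a∼u s 2s≤d = *x^-cancelʳ _ _ (2 ℕ.* s) (begin
      a s * x ^ (2 ℕ.* s)                              ≈⟨ *-congˡ (^-assocʳ x 2 s) ⟨
      a s * Q ^ s                                      ≈⟨ a∼u s ⟩
      ι (u s) * x ^ d                                  ≡⟨ cong (λ e → ι (u s) * x ^ e) (ℕ.m∸n+n≡m 2s≤d) ⟨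
      ι (u s) * x ^ (d ∸ 2 ℕ.* s ℕ.+ 2 ℕ.* s)          ≈⟨ *-congˡ (^-homo-* x (d ∸ 2 ℕ.* s) (2 ℕ.* s)) ⟩
      ι (u s) * (x ^ (d ∸ 2 ℕ.* s) * x ^ (2 ℕ.* s))    ≈⟨ *-assoc _ _ _ ⟨
      ι (u s) * x ^ (d ∸ 2 ℕ.* s) * x ^ (2 ℕ.* s)      ∎)

    -- Serves the small n, where 2s can exceed the exponent of the weight.
    ∼⇒≈0 : ∀ {a u δ} → a ∼[ δ ] u → ∀ s → u s ≡ 0ℤ → a s ≈ 0#
    ∼⇒≈0 {a} {u} {δ} a∼u s us≡0 = *x^-cancelʳ _ _ (2 ℕ.* s) (begin
      a s * x ^ (2 ℕ.* s)  ≈⟨ *-congˡ (^-assocʳ x 2 s) ⟨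
      a s * Q ^ s          ≈⟨ a∼u s ⟩
      ι (u s) * δ          ≡⟨ cong (λ z → ι z * δ) us≡0 ⟩
      ι 0ℤ * δ             ≈⟨ *-congʳ ι-0 ⟩
      0# * δ               ≈⟨ zeroˡ δ ⟩
      0#                   ≈⟨ zeroˡ _ ⟨
      0# * x ^ (2 ℕ.* s)   ∎)

-- The embedding of ℤ into ℚ[q].

/1-homo-+ : ∀ a b → (a ℤ.+ b) / 1 ≡ (a / 1) ℚ.+ (b / 1)
-- `_/_` normalises its result, so the sums are compared as unnormalised fractions; the 0 in
-- `mkℚᵘ a 0` encodes denominator 1.
/1-homo-+ a b = ℚ.toℚᵘ-injective (begin
  ℚ.toℚᵘ ((a ℤ.+ b) / 1)              ≈⟨ ℚ.toℚᵘ-fromℚᵘ (mkℚᵘ (a ℤ.+ b) 0) ⟩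
  mkℚᵘ (a ℤ.+ b) 0                    ≈⟨ *≡* (unit a b) ⟩
  mkℚᵘ a 0 ℚᵘ.+ mkℚᵘ b 0              ≈⟨ ℚᵘ.+-cong (ℚ.toℚᵘ-fromℚᵘ (mkℚᵘ a 0))
                                                  (ℚ.toℚᵘ-fromℚᵘ (mkℚᵘ b 0)) ⟨
  ℚ.toℚᵘ (a / 1) ℚᵘ.+ ℚ.toℚᵘ (b / 1)  ≈⟨ ℚ.toℚᵘ-homo-+ (a / 1) (b / 1) ⟨
  ℚ.toℚᵘ ((a / 1) ℚ.+ (b / 1))        ∎)
  where
  open SetoidReasoning ℚᵘ.≃-setoid
  unit : ∀ a b → (a ℤ.+ b) ℤ.* 1ℤ ≡ (a ℤ.* 1ℤ ℤ.+ b ℤ.* 1ℤ) ℤ.* 1ℤ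
  unit = solve-∀

/1-homo-* : ∀ a b → (a ℤ.* b) / 1 ≡ (a / 1) ℚ.* (b / 1)
/1-homo-* a b = ℚ.toℚᵘ-injective (begin
  ℚ.toℚᵘ ((a ℤ.* b) / 1)              ≈⟨ ℚ.toℚᵘ-fromℚᵘ (mkℚᵘ (a ℤ.* b) 0) ⟩
  mkℚᵘ a 0 ℚᵘ.* mkℚᵘ b 0              ≈⟨ ℚᵘ.*-cong (ℚ.toℚᵘ-fromℚᵘ (mkℚᵘ a 0))
                                                  (ℚ.toℚᵘ-fromℚᵘ (mkℚᵘ b 0)) ⟨
  ℚ.toℚᵘ (a / 1) ℚᵘ.* ℚ.toℚᵘ (b / 1)  ≈⟨ ℚ.toℚᵘ-homo-* (a / 1) (b / 1) ⟨
  ℚ.toℚᵘ ((a / 1) ℚ.* (b / 1))        ∎)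
  where open SetoidReasoning ℚᵘ.≃-setoid

module ℚ[q] = PolynomialRing ℚ.+-*-commutativeRing
module ℚ[q][p] = PolynomialRing ℚ[q].polynomialRing
module ℚ[q][p][x] = PolynomialRing ℚ[q][p].polynomialRing

open Defs using (_≈_; _*_; 0#; _^_)

fromℤ-+ : ∀ a b → fromℤ (a ℤ.+ b) ≈ (fromℤ a Poly-q.+ᴾ fromℤ b)
fromℤ-+ a b zero    = /1-homo-+ a b
fromℤ-+ a b (suc k) = ≡.refl

fromℤ-* : ∀ a b → fromℤ (a ℤ.* b) ≈ fromℤ a * fromℤ b
fromℤ-* a b zero    = ≡.trans (/1-homo-* a b) (≡.sym (ℚ.+-identityʳ _))
fromℤ-* a b (suc k) = ≡.refl

-- The lists differ, a single zero against `[]`, but their coefficients agree.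
fromℤ-0 : fromℤ 0ℤ ≈ 0#
fromℤ-0 zero    = ≡.refl
fromℤ-0 (suc k) = ≡.refl

fromℤ-homo : SemiringMorphisms.IsSemiringHomomorphism ℤ.+-*-rawSemiring (RawRing.rawSemiring ℚ[q]) fromℤ
fromℤ-homo = record
  { isNearSemiringHomomorphism = record
    { +-isMonoidHomomorphism = record
      { isMagmaHomomorphism = record
        { isRelHomomorphism = record { cong = λ { ≡.refl _ → ≡.refl } }
        ; homo = fromℤ-+
        }
      ; ε-homo = fromℤ-0
      }
    ; *-homo = fromℤ-*
    }
  ; 1#-homo = λ _ → ≡.refl
  }

-- The linear coefficient of the rising factorial as a product of the Fₘ.

open ScaledCoefficients
open Scaling ℚ[q].polynomialRing fromℤ fromℤ-homo q

-- Index 2 is treated apart because `F 2` is an initial value, whereas `F̂ 2` already comes from the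
-- recurrence.
F∼F̂ : ∀ m → Poly-p.coeff (F m) ∼[ q ^ m ] ℤ[t].coeff (F̂ m)
F∼F̂ 0                   = ∼-0 (q ^ 0)
F∼F̂ 1                   = F₁∼F̂₁
F∼F̂ 2                   = F₂∼F̂₂
F∼F̂ (suc (suc (suc m))) =
  F∼F̂-step {F (suc (suc m))} {F (suc m)} (suc m) (F∼F̂ (suc (suc m))) (F∼F̂ (suc m))

-- The first factor of the rising factorial is x itself.
cf-0 : ∀ n → Poly-p._≈ᴾ_ (cf (suc n) 0) []
cf-0 zero    = λ _ _ → ≡.refl
cf-0 (suc n) = begin
  cf (suc (suc n)) 0
    ≈⟨ ℚ[q][p][x].coeff-* (rising Poly-x.X (suc n)) (Poly-x.X Poly-x.+ᴾ Poly-x.const (F (suc n))) 0 ⟩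
  -- The constant coefficient of the new factor computes to `F (suc n)`, since the zero `[]` is a
  -- definitional left unit of addition.
  cf (suc n) 0 · F (suc n)
    ≈⟨ *-congʳ {F (suc n)} {cf (suc n) 0} {[]} (cf-0 n) ⟩
  [] ∎
  where
  open CommutativeRing ℚ[q][p].polynomialRing using (setoid; *-congʳ) renaming (_*_ to _·_)
  open SetoidReasoning setoid

-- A factor x + F contributes either its x, against a constant coefficient that vanishes by `cf-0`,
-- or its F.
cf-1-suc : ∀ n → Poly-p._≈ᴾ_ (cf (suc (suc n)) 1) (cf (suc n) 1 Poly-p.*ᴾ F (suc n))
cf-1-suc n = begin
  cf (suc (suc n)) 1
    ≈⟨ ℚ[q][p][x].coeff-* (rising Poly-x.X (suc n)) (Poly-x.X Poly-x.+ᴾ Poly-x.const (F (suc n))) 1 ⟩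
  (cf (suc n) 0 · Poly-p.const (Poly-q.const ℚ.1ℚ)) Poly-p.+ᴾ (cf (suc n) 1 · F (suc n))
    ≈⟨ +-congʳ {cf (suc n) 1 · F (suc n)} {cf (suc n) 0 · Poly-p.const (Poly-q.const ℚ.1ℚ)} {[]}
         (*-congʳ {Poly-p.const (Poly-q.const ℚ.1ℚ)} {cf (suc n) 0} {[]} (cf-0 n)) ⟩
  cf (suc n) 1 · F (suc n) ∎
  where
  open CommutativeRing ℚ[q][p].polynomialRing using (setoid; *-congʳ; +-congʳ) renaming (_*_ to _·_)
  open SetoidReasoning setoid

[1+n]C2+[1+n]≡[2+n]C2 : ∀ n → suc n C 2 ℕ.+ suc n ≡ suc (suc n) C 2
[1+n]C2+[1+n]≡[2+n]C2 n = begin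
  suc n C 2 ℕ.+ suc n      ≡⟨ ℕ.+-comm (suc n C 2) (suc n) ⟩
  suc n ℕ.+ suc n C 2      ≡⟨ cong (ℕ._+ suc n C 2) (nC1≡n (suc n)) ⟨
  suc n C 1 ℕ.+ suc n C 2  ≡⟨ nCk+nC[k+1]≡[n+1]C[k+1] (suc n) 1 ⟩
  suc (suc n) C 2          ∎
  where open ≡.≡-Reasoning

-- The weights q¹, ..., qⁿ of the factors multiply to q^(1 + ⋯ + n), whose exponent is C(n+1,2).
cf∼Ĝ : ∀ n → Poly-p.coeff (cf (suc n) 1) ∼[ q ^ (suc n C 2) ] ℤ[t].coeff (Ĝ n)
cf∼Ĝ zero    = ∼-const (Poly-q.const ℚ.1ℚ)
cf∼Ĝ (suc n) = ∼-resp {cf′*F} {Poly-p.coeff (cf (suc (suc n)) 1)} {δ} {ε} {ℤ[t].coeff (Ĝ (suc n))}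
  (λ s → sym {cf (suc (suc n)) 1 ∣p^ s} {cf′*F s} (cf-1-suc n s))
  (trans {δ} {q ^ (suc n C 2 ℕ.+ suc n)} {ε}
    (sym {q ^ (suc n C 2 ℕ.+ suc n)} {δ} (Exp.^-homo-* semiring q (suc n C 2) (suc n)))
    (reflexive (cong (q ^_) ([1+n]C2+[1+n]≡[2+n]C2 n))))
  (λ _ → ≡.refl)
  (∼-*ᴾ {cf (suc n) 1} {F (suc n)} {q ^ (suc n C 2)} {q ^ suc n} {Ĝ n} {F̂ (suc n)}
    (cf∼Ĝ n) (F∼F̂ (suc n)))
  where
  open CommutativeRing ℚ[q].polynomialRing using (Carrier; sym; trans; reflexive; semiring)
  cf′*F : ℕ → Carrier
  cf′*F = Poly-p.coeff (cf (suc n) 1 Poly-p.*ᴾ F (suc n))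

  δ ε : Carrier
  δ = q ^ (suc n C 2) * q ^ suc n
  ε = q ^ (suc (suc n) C 2)

-- Reading off the coefficients of p⁰ to p³.

6≤[4+n]C2 : ∀ n → 6 ≤ (4 ℕ.+ n) C 2
-- Since 6 = 2 · 3 is the largest drop of the exponent, this one bound serves s = 1, 2, 3.
6≤[4+n]C2 zero    = ℕ.≤-refl
6≤[4+n]C2 (suc n) = ℕ.≤-trans (6≤[4+n]C2 n)
  (ℕ.≤-trans (ℕ.m≤m+n _ (4 ℕ.+ n)) (ℕ.≤-reflexive ([1+n]C2+[1+n]≡[2+n]C2 (3 ℕ.+ n))))

cf-coeff : ∀ n s {N} → ℤ[t].coeff (Ĝ n) s ≡ N → 2 ℕ.* s ≤ suc n C 2 →
           cf (suc n) 1 ∣p^ s ≈ fromℤ N * q ^ ((suc n C 2) ∸ 2 ℕ.* s)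
cf-coeff n s ≡.refl 2s≤ = ∼⇒≈ ℚ[q].X*-cancelˡ
  {Poly-p.coeff (cf (suc n) 1)} {ℤ[t].coeff (Ĝ n)} (cf∼Ĝ n) s 2s≤

cf-coeff-0 : ∀ n s → ℤ[t].coeff (Ĝ n) s ≡ 0ℤ → cf (suc n) 1 ∣p^ s ≈ 0#
cf-coeff-0 n s = ∼⇒≈0 ℚ[q].X*-cancelˡ
  {Poly-p.coeff (cf (suc n) 1)} {ℤ[t].coeff (Ĝ n)} {q ^ (suc n C 2)} (cf∼Ĝ n) s

theorem14 :
    (∀ n → 1 ≤ n → cf n 1 ∣p^ 0 ≈ q ^ (n C 2))
  × (∀ n → 1 ≤ n → n ≤ 3 → cf n 1 ∣p^ 1 ≈ 0#)
  × (∀ n → 4 ≤ n → cf n 1 ∣p^ 1 ≈ fromℤ (+ ((n ∸ 2) C 2)) * q ^ ((n C 2) ∸ 2))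
  × (∀ n → 1 ≤ n → n ≤ 4 → cf n 1 ∣p^ 2 ≈ 0#)
  × (∀ n → 5 ≤ n → cf n 1 ∣p^ 2 ≈ fromℤ (+ 3 ℤ.* + ((n ∸ 1) C 4) ℤ.- + ((n ∸ 3) C 2)) * q ^ ((n C 2) ∸ 4))
  × (∀ n → 1 ≤ n → n ≤ 5 → cf n 1 ∣p^ 3 ≈ 0#)
  × (∀ n → 5 ≤ n → cf n 1 ∣p^ 3 ≈ fromℤ (+ 15 ℤ.* + (n C 6) ℤ.- + 6 ℤ.* + ((n ∸ 2) C 4) ℤ.+ + ((n ∸ 4) C 4)) * q ^ ((n C 2) ∸ 6))
theorem14 = p⁰ , p¹-zero , p¹ , p²-zero , p² , p³-zero , p³
  where
  4≤6 : 4 ≤ 6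
  4≤6 = s≤s (s≤s (s≤s (s≤s z≤n)))

  2≤6 : 2 ≤ 6
  2≤6 = s≤s (s≤s z≤n)

  p⁰ : ∀ n → 1 ≤ n → cf n 1 ∣p^ 0 ≈ q ^ (n C 2)
  p⁰ (suc n) _ = trans {cf (suc n) 1 ∣p^ 0} {fromℤ 1ℤ * q ^ (suc n C 2)} {q ^ (suc n C 2)}
    (cf-coeff n 0 (coeff₀-Ĝ n) z≤n) (*-identityˡ (q ^ (suc n C 2)))
    where open CommutativeRing ℚ[q].polynomialRing using (trans; *-identityˡ)

  p¹-zero : ∀ n → 1 ≤ n → n ≤ 3 → cf n 1 ∣p^ 1 ≈ 0#
  -- For each of the finitely many n, the coefficient of `Ĝ` is evaluated outright.
  p¹-zero 1 _ _ = cf-coeff-0 0 1 ≡.refl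
  p¹-zero 2 _ _ = cf-coeff-0 1 1 ≡.refl
  p¹-zero 3 _ _ = cf-coeff-0 2 1 ≡.refl
  p¹-zero (suc (suc (suc (suc n)))) _ (s≤s (s≤s (s≤s ())))

  p¹ : ∀ n → 4 ≤ n → cf n 1 ∣p^ 1 ≈ fromℤ (+ ((n ∸ 2) C 2)) * q ^ ((n C 2) ∸ 2)
  p¹ (suc (suc (suc (suc n)))) _ = cf-coeff (3 ℕ.+ n) 1
    (≡.trans (coeff₁-Ĝ (2 ℕ.+ n)) (β≡C (2 ℕ.+ n) 2))
    (ℕ.≤-trans 2≤6 (6≤[4+n]C2 n))
  p¹ 1 (s≤s ())
  p¹ 2 (s≤s (s≤s ()))
  p¹ 3 (s≤s (s≤s (s≤s ())))

  p²-zero : ∀ n → 1 ≤ n → n ≤ 4 → cf n 1 ∣p^ 2 ≈ 0#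
  p²-zero 1 _ _ = cf-coeff-0 0 2 ≡.refl
  p²-zero 2 _ _ = cf-coeff-0 1 2 ≡.refl
  p²-zero 3 _ _ = cf-coeff-0 2 2 ≡.refl
  p²-zero 4 _ _ = cf-coeff-0 3 2 ≡.refl
  p²-zero (suc (suc (suc (suc (suc n))))) _ (s≤s (s≤s (s≤s (s≤s ()))))

  p² : ∀ n → 5 ≤ n → cf n 1 ∣p^ 2 ≈
       fromℤ (+ 3 ℤ.* + ((n ∸ 1) C 4) ℤ.- + ((n ∸ 3) C 2)) * q ^ ((n C 2) ∸ 4)
  p² (suc (suc (suc (suc (suc n))))) _ = cf-coeff (4 ℕ.+ n) 2
    (≡.trans (coeff₂-Ĝ (2 ℕ.+ n))
      (cong₂ (λ a b → + 3 ℤ.* a ℤ.- b) (β≡C (4 ℕ.+ n) 4) (β≡C (2 ℕ.+ n) 2)))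
    (ℕ.≤-trans 4≤6 (6≤[4+n]C2 (suc n)))
  p² 1 (s≤s ())
  p² 2 (s≤s (s≤s ()))
  p² 3 (s≤s (s≤s (s≤s ())))
  p² 4 (s≤s (s≤s (s≤s (s≤s ()))))

  p³-zero : ∀ n → 1 ≤ n → n ≤ 5 → cf n 1 ∣p^ 3 ≈ 0#
  p³-zero 1 _ _ = cf-coeff-0 0 3 ≡.refl
  p³-zero 2 _ _ = cf-coeff-0 1 3 ≡.refl
  p³-zero 3 _ _ = cf-coeff-0 2 3 ≡.refl
  p³-zero 4 _ _ = cf-coeff-0 3 3 ≡.refl
  p³-zero 5 _ _ = cf-coeff-0 4 3 ≡.refl
  p³-zero (suc (suc (suc (suc (suc (suc n)))))) _ (s≤s (s≤s (s≤s (s≤s (s≤s ())))))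

  p³ : ∀ n → 5 ≤ n → cf n 1 ∣p^ 3 ≈
       fromℤ (+ 15 ℤ.* + (n C 6) ℤ.- + 6 ℤ.* + ((n ∸ 2) C 4) ℤ.+ + ((n ∸ 4) C 4)) * q ^ ((n C 2) ∸ 6)
  -- At index 5 all three binomial coefficients vanish, so this agrees with `p³-zero` on the
  -- overlap.
  p³ (suc (suc (suc (suc (suc n))))) _ = cf-coeff (4 ℕ.+ n) 3
    (≡.trans (coeff₃-Ĝ (1 ℕ.+ n))
      (cong₂ ℤ._+_
        (cong₂ (λ a b → + 15 ℤ.* a ℤ.- + 6 ℤ.* b) (β≡C (5 ℕ.+ n) 6) (β≡C (3 ℕ.+ n) 4))
        (β≡C (1 ℕ.+ n) 4)))
    (6≤[4+n]C2 (suc n))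
  p³ 1 (s≤s ())
  p³ 2 (s≤s (s≤s ()))
  p³ 3 (s≤s (s≤s (s≤s ())))
  p³ 4 (s≤s (s≤s (s≤s (s≤s ()))))
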